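{- Let $\mathcal{H}$ be a pseudohemisphere hypergraph on a finite totally ordered vertex set $V$ with $|V|=n\ge 2$. If every pair of vertices of $V$ is contained in some hyperedge $H\in\mathcal{H}$, then there exist at most $4$ hyperedges of $\mathcal{H}$ whose union is $V$.
   Context: A hypergraph $\mathcal{F}$ on a totally ordered finite vertex set $V$ (a family of subsets of $V$) is ABA-free if there are no two hyperedges $A,B\in\mathcal{F}$ and vertices $x<y<z$ with $x,z\in A\setminus B$ and $y\in B\setminus A$. For $F\subseteq V$ write $\bar F=V\setminus F$, and $\Delta$ denotes symmetric difference. A hypergraph $\mathcal{H}$ on $V$ is a pseudohemisphere hypergraph if there exist a set $X\subseteq V$ and an ABA-free hypergraph $\mathcal{F}$ on $V$ such that every hyperedge of $\mathcal{H}$ belongs to $\{F\Delta X,\ \bar F\Delta X : F\in\mathcal{F}\}$. -}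

module Defs where

open import Data.Nat using (ℕ)
open import Data.Bool using (_xor_)
open import Data.Fin using (Fin; _<_)
open import Data.Fin.Subset using (Subset; _∈_; _∉_; ∁)
open import Data.Vec using (zipWith)
open import Data.List using (List)
open import Data.List.Membership.Propositional using () renaming (_∈_ to _∈ₗ_)
open import Data.Product using (Σ; _×_; ∃-syntax)
open import Data.Sum using (_⊎_)
open import Relation.Binary.PropositionalEquality using (_≡_)
open import Relation.Nullary using (¬_)

-- The vertex set V is Fin n with its natural total order.
-- A hypergraph on V is a finite family of subsets, given as a list
-- (repetitions are irrelevant for all notions used here).
Hypergraph : ℕ → Set
Hypergraph n = List (Subset n)

_Δ_ : ∀ {n} → Subset n → Subset n → Subset n
A Δ B = zipWith _xor_ A B

ABA-free : ∀ {n} → Hypergraph n → Set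
ABA-free {n} 𝓕 =
  ∀ (A B : Subset n) → A ∈ₗ 𝓕 → B ∈ₗ 𝓕 →
  ∀ (x y z : Fin n) → x < y → y < z →
  ¬ ((x ∈ A × x ∉ B) × (z ∈ A × z ∉ B) × (y ∈ B × y ∉ A))

IsPseudohemisphere : ∀ {n} → Hypergraph n → Set
IsPseudohemisphere {n} 𝓗 =
  Σ (Subset n) λ X → Σ (Hypergraph n) λ 𝓕 → ABA-free 𝓕 ×
  (∀ H → H ∈ₗ 𝓗 → ∃[ F ] (F ∈ₗ 𝓕 × (H ≡ F Δ X ⊎ H ≡ ∁ F Δ X)))

{-# OPTIONS --safe #-}

-- Call K ∋ v, L ∌ v a pair of hyperedges.  Choose v so that the set of
-- hyperedges through v is inclusion-minimal; then every vertex w either lies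
-- in all hyperedges through v, or lies in both members of some pair.
-- Read the order of V cyclically from v, changing signs where it wraps
-- around, and reverse a ⊲ b whenever some member of 𝓕 has signs (−,+,−) on
-- v, a, b: the result ≺ is a total order, the order in which the other
-- vertices are seen from v.  Each pair (K, L) then cuts (V, ≺) in one place:
-- up to the fixed signs x, the vertices in K ∩ L lie on one side of the cut
-- and those outside K ∪ L on the other.  So the pairs behave like half-circles,
-- and as for vectors in the plane (Carathéodory), of any four the first, second or third is
-- covered by the others.  Hence three pairs cover V.  Exchanging
-- with mixed pairs (Kᵢ , Lⱼ) leaves three pairs built from only four
-- hyperedges, which is Kirchberger's theorem in the plane.

module Submission where

open import Defs
open import Data.Nat using (ℕ; _≤_; s≤s; z≤n)
open import Data.Nat.Properties using (≤-refl)
open import Data.Fin using (Fin; zero; suc; _<_)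
open import Data.Fin.Properties using (_≟_; _<?_; <-cmp; <-trans; <-irrefl; any?; all?; ¬∀⟶∃¬)
open import Data.Fin.Subset using (Subset; _∈_; _∉_; ⊤; ⋃; ∁)
open import Data.Fin.Subset.Properties using (_∈?_; ⊆-antisym; ⊆⊤; x∈p∪q⁺)
open import Data.Bool using (Bool; true; false; not; _xor_)
import Data.Bool.Properties as Bool
open import Algebra.Bundles using (CommutativeRing)
open import Algebra.Properties.CommutativeSemigroup
  (CommutativeRing.+-commutativeSemigroup Bool.xor-∧-commutativeRing) using (interchange)
open import Data.List using (List; []; _∷_; length; allFin)
open import Data.List.Relation.Unary.All using (All; []; _∷_)
import Data.List.Relation.Unary.All as All
open import Data.List.Relation.Unary.All.Properties using (¬All⇒Any¬)
open import Data.List.Relation.Unary.Any using (Any; here; there)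
import Data.List.Relation.Unary.Any as Any
open import Data.List.Membership.Propositional using (find; lose) renaming (_∈_ to _∈ₗ_)
open import Data.List.Membership.Propositional.Properties using (∈-allFin)
open import Data.Product using (Σ; _×_; _,_; proj₁; proj₂; ∃-syntax; Σ-syntax)
open import Data.Sum using (_⊎_; inj₁; inj₂; [_,_]′)
import Data.Sum as Sum
open import Data.Empty using (⊥; ⊥-elim)
open import Data.Vec using (lookup)
open import Data.Vec.Properties using ([]=⇒lookup; lookup⇒[]=; lookup-zipWith; lookup-map)
open import Function using (_∘_; id)
open import Level using (0ℓ)
open import Relation.Nullary using (¬_; Dec; yes; no; does; contradiction)
open import Relation.Nullary.Decidable using (_×-dec_; _⊎-dec_; _→-dec_; dec-true; dec-false; decidable-stable)
open import Relation.Binary using (Rel; Reflexive; Transitive; Decidable; Trichotomous; IsStrictTotalOrder;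
  tri<; tri≈; tri>)
open import Relation.Binary.PropositionalEquality using (_≡_; _≢_; refl; sym; trans; cong; subst;
  isEquivalence; resp₂; module ≡-Reasoning)
import Relation.Unary as U

private variable n : ℕ

-- Membership bits, unions and minimal elements

does⇒ : {A : Set} (a? : Dec A) → does a? ≡ true → A
does⇒ (yes a) _ = a

does⇒¬ : {A : Set} (a? : Dec A) → does a? ≡ false → ¬ A
does⇒¬ (no ¬a) _ = ¬a

lookup-∈ : {x : Fin n} {p : Subset n} → lookup p x ≡ true → x ∈ p
lookup-∈ {x = x} {p} = lookup⇒[]= x p

lookup-∉ : {x : Fin n} {p : Subset n} → lookup p x ≡ false → x ∉ p
lookup-∉ px≡f x∈p with () ← trans (sym px≡f) ([]=⇒lookup x∈p)

∉-lookup : {x : Fin n} {p : Subset n} → x ∉ p → lookup p x ≡ false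
∉-lookup x∉p = Bool.¬-not (x∉p ∘ lookup-∈)

⋃≡⊤ : (ps : List (Subset n)) → (∀ x → Any (x ∈_) ps) → ⋃ ps ≡ ⊤
⋃≡⊤ ps covered = ⊆-antisym ⊆⊤ (λ {x} _ → ∈⋃ (covered x))
  where
  ∈⋃ : ∀ {x qs} → Any (x ∈_) qs → x ∈ ⋃ qs
  ∈⋃ {qs = q ∷ qs} (here x∈q)   = x∈p∪q⁺ {q = ⋃ qs} (inj₁ x∈q)
  ∈⋃ {qs = q ∷ qs} (there x∈qs) = x∈p∪q⁺ {p = q} (inj₂ (∈⋃ x∈qs))

-- A new head replaces the minimum `m` of the tail exactly when it lies below `m`; transitivity
-- through `m` then gives its minimality against the tail.
minimal : {A : Set} {_≲_ : Rel A 0ℓ} → Reflexive _≲_ → Transitive _≲_ → Decidable _≲_ →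
          ∀ x xs → ∃[ m ] (∀ {y} → y ∈ₗ x ∷ xs → y ≲ m → m ≲ y)
minimal ≲-refl ≲-trans _≲?_ x [] = x , λ { (here refl) _ → ≲-refl }
minimal {_≲_ = _≲_} ≲-refl ≲-trans _≲?_ x (y ∷ ys) with minimal ≲-refl ≲-trans _≲?_ y ys
... | m , m-min with x ≲? m
...   | no x≴m = m , λ { (here refl) x≲m → contradiction x≲m x≴m ; (there z∈) → m-min z∈ }
...   | yes x≲m = x , λ { (here refl) _ → ≲-refl
                        ; (there z∈) z≲x → ≲-trans x≲m (m-min z∈ (≲-trans z≲x x≲m)) }

private
  isSTO : {A : Set} {_<_ : Rel A 0ℓ} → (∀ {a} → ¬ (a < a)) → Transitive _<_ →
          Decidable (_≡_ {A = A}) → (∀ {a b} → a ≢ b → a < b ⊎ b < a) → IsStrictTotalOrder _≡_ _<_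
  isSTO {_<_ = _<_} irr <-tr _≡?_ total = record
    { isStrictPartialOrder = record
      { isEquivalence = isEquivalence
      ; irrefl        = λ { refl → irr }
      ; trans         = <-tr
      ; <-resp-≈      = resp₂ _<_
      }
    ; compare = cmp
    }
    where
    cmp : Trichotomous _≡_ _<_
    cmp a b with a ≡? b
    ... | yes refl = tri≈ irr refl irr
    ... | no a≢b with total a≢b
    ...   | inj₁ a<b = tri< a<b a≢b (irr ∘ <-tr a<b)
    ...   | inj₂ b<a = tri> (irr ∘ <-tr b<a) a≢b b<a

-- Reversing the pairs in T, the inversion set of a permutation.
module Inversion {A : Set} {_⊲_ T : Rel A 0ℓ} (sto : IsStrictTotalOrder _≡_ _⊲_) (T? : Decidable T)
  (closed   : ∀ {a b c} → a ⊲ b → b ⊲ c → T a b → T b c → T a c)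
  (coclosed : ∀ {a b c} → a ⊲ b → b ⊲ c → T a c → T a b ⊎ T b c) where

  open IsStrictTotalOrder sto
    using () renaming (trans to ⊲-trans; irrefl to ⊲-irrefl; compare to ⊲-cmp; _≟_ to _≡?_)

  infix 4 _≺_
  _≺_ : Rel A 0ℓ
  a ≺ b = (a ⊲ b × ¬ T a b) ⊎ (b ⊲ a × T b a)

  ≺-irrefl : ∀ {a} → ¬ (a ≺ a)
  ≺-irrefl (inj₁ (a⊲a , _)) = ⊲-irrefl refl a⊲a
  ≺-irrefl (inj₂ (a⊲a , _)) = ⊲-irrefl refl a⊲a

  ≺-total : ∀ {a b} → a ≢ b → a ≺ b ⊎ b ≺ a
  ≺-total {a} {b} a≢b with ⊲-cmp a b
  ... | tri≈ _ a≡b _ = contradiction a≡b a≢b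
  ... | tri< a⊲b _ _ with T? a b
  ...   | yes t = inj₂ (inj₂ (a⊲b , t))
  ...   | no ¬t = inj₁ (inj₁ (a⊲b , ¬t))
  ≺-total {a} {b} a≢b | tri> _ _ b⊲a with T? b a
  ...   | yes t = inj₁ (inj₂ (b⊲a , t))
  ...   | no ¬t = inj₂ (inj₁ (b⊲a , ¬t))

  -- Two kept pairs compose by `coclosed`, two reversed pairs by `closed`. If one pair is kept and
  -- one reversed, the position of `c` relative to `a` in `⊲` decides which of the two conditions
  -- applies.
  ≺-trans : Transitive _≺_
  ≺-trans (inj₁ (a⊲b , ¬ab)) (inj₁ (b⊲c , ¬bc)) =
    inj₁ (⊲-trans a⊲b b⊲c , [ ¬ab , ¬bc ]′ ∘ coclosed a⊲b b⊲c)
  ≺-trans (inj₂ (b⊲a , ba)) (inj₂ (c⊲b , cb)) =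
    inj₂ (⊲-trans c⊲b b⊲a , closed c⊲b b⊲a cb ba)
  ≺-trans {a} {b} {c} (inj₁ (a⊲b , ¬ab)) (inj₂ (c⊲b , cb)) with ⊲-cmp a c
  ... | tri≈ _ refl _ = contradiction cb ¬ab
  ... | tri< a⊲c _ _  = inj₁ (a⊲c , λ ac → ¬ab (closed a⊲c c⊲b ac cb))
  ... | tri> _ _ c⊲a  = inj₂ (c⊲a , [ id , (λ ab → contradiction ab ¬ab) ]′ (coclosed c⊲a a⊲b cb))
  ≺-trans {a} {b} {c} (inj₂ (b⊲a , ba)) (inj₁ (b⊲c , ¬bc)) with ⊲-cmp a c
  ... | tri≈ _ refl _ = contradiction ba ¬bc
  ... | tri< a⊲c _ _  = inj₁ (a⊲c , λ ac → ¬bc (closed b⊲a a⊲c ba ac))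
  ... | tri> _ _ c⊲a  = inj₂ (c⊲a , [ (λ bc → contradiction bc ¬bc) , id ]′ (coclosed b⊲c c⊲a ba))

  ≺-isStrictTotalOrder : IsStrictTotalOrder _≡_ _≺_
  ≺-isStrictTotalOrder = isSTO ≺-irrefl ≺-trans _≡?_ ≺-total

-- Single cuts of a linear order

module Cuts {n} {_≺_ : Rel (Fin n) 0ℓ} (sto : IsStrictTotalOrder _≡_ _≺_) where

  open IsStrictTotalOrder sto
    using () renaming (trans to ≺-trans; compare to ≺-cmp; _<?_ to _≺?_)

  -- Both fibres of `g` are convex, so along `≺` it changes value at most once.
  Cut : (Fin n → Bool) → Set
  Cut g = ∀ {a b c} → a ≺ b → b ≺ c → g a ≡ g c → g b ≡ g a

  antitone⇒cut : ∀ {g} → (∀ {a b} → a ≺ b → g b ≡ true → g a ≡ true) → Cut g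
  antitone⇒cut {g} anti {a} {b} {c} a≺b b≺c ga≡gc with g a in ga | g b in gb
  ... | true  | true  = refl
  ... | false | false = refl
  ... | true  | false = trans (sym gb) (anti b≺c (sym ga≡gc))
  ... | false | true  = trans (sym (anti a≺b gb)) ga

  not-cut : ∀ {g} → Cut g → Cut (not ∘ g)
  not-cut cut a≺b b≺c eq = cong not (cut a≺b b≺c (Bool.not-injective eq))

  module _ {Q : Fin n → Set} (Q? : U.Decidable Q) where

    Below : Fin n → Set
    Below w = ∃[ m ] ((w ≡ m ⊎ w ≺ m) × Q m)

    below? : U.Decidable Below
    below? w = any? (λ m → ((w ≟ m) ⊎-dec (w ≺? m)) ×-dec Q? m)

    below-cut : Cut (λ w → does (below? w))
    below-cut = antitone⇒cut λ {a} {b} a≺b → anti a≺b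
      where
      anti : ∀ {a b} → a ≺ b → does (below? b) ≡ true → does (below? a) ≡ true
      anti {a} {b} a≺b eq with below? b
      ... | yes (m , inj₁ refl , qm) = dec-true (below? a) (m , inj₂ a≺b , qm)
      ... | yes (m , inj₂ b≺m , qm)  = dec-true (below? a) (m , inj₂ (≺-trans a≺b b≺m) , qm)

  Agree : (k l : Fin n → Bool) → Fin n → Bool → Set
  Agree k l w p = k w ≡ p × l w ≡ p

  agree? : ∀ k l p → U.Decidable (λ w → Agree k l w p)
  agree? k l p w = (k w Bool.≟ p) ×-dec (l w Bool.≟ p)

  module _ (k l : Fin n → Bool)
    (noAlt : ∀ {a b c} p → a ≺ b → b ≺ c →
             Agree k l a p → Agree k l b (not p) → Agree k l c p → ⊥) where

    private
      disjoint : ∀ {w} → Agree k l w true → ¬ Agree k l w false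
      disjoint (kt , _) (kf , _) with () ← trans (sym kt) kf

      -- Compare the upper end `b` of the rise with the lower end `d` of the fall: either `a`, `b`,
      -- `d` or `c`, `d`, `b` alternates.
      rise-fall : ∀ {a b c d} → a ≺ b → Agree k l a false → Agree k l b true →
                  c ≺ d → Agree k l c true → Agree k l d false → ⊥
      rise-fall {b = b} {c} {d} a≺b fa tb c≺d tc fd with ≺-cmp b d
      ... | tri< b≺d _ _  = noAlt false a≺b b≺d fa tb fd
      ... | tri≈ _ refl _ = disjoint tb fd
      ... | tri> _ _ d≺b  = noAlt true c≺d d≺b tc fd tb

      Rise : Fin n → Fin n → Set
      Rise a b = a ≺ b × Agree k l a false × Agree k l b true

      rise? : Dec (∃[ a ] ∃[ b ] Rise a b)
      rise? = any? λ a → any? λ b → (a ≺? b) ×-dec (agree? k l false a ×-dec agree? k l true b)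

    -- The agreed values cannot both rise and fall, so they are monotone along `≺`. If they rise,
    -- the cut is placed right after the last agreed `false`; otherwise right after the last agreed
    -- `true`.
    complete : Σ[ g ∈ (Fin n → Bool) ] Cut g × (∀ {w} p → Agree k l w p → g w ≡ p)
    complete with rise?
    ... | yes (a , b , a≺b , fa , tb) =
      (λ w → not (does (neg? w))) , not-cut (below-cut _) , agrees
      where
      neg? = below? (agree? k l false)
      agrees : ∀ {w} p → Agree k l w p → not (does (neg? w)) ≡ p
      agrees {w} false fw = cong not (dec-true (neg? w) (w , inj₁ refl , fw))
      agrees {w} true  tw = cong not (dec-false (neg? w)
        λ { (m , inj₁ refl , fm) → disjoint tw fm
          ; (m , inj₂ w≺m , fm) → rise-fall a≺b fa tb w≺m tw fm })
    ... | no ¬rise = (λ w → does (pos? w)) , below-cut _ , agrees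
      where
      pos? = below? (agree? k l true)
      agrees : ∀ {w} p → Agree k l w p → does (pos? w) ≡ p
      agrees {w} true  tw = dec-true (pos? w) (w , inj₁ refl , tw)
      agrees {w} false fw = dec-false (pos? w)
        λ { (m , inj₁ refl , tm) → disjoint tm fw
          ; (m , inj₂ w≺m , tm) → ¬rise (w , m , w≺m , fw , tm) }

  -- Half-circles and the exchange property

  module _ (x : Fin n → Bool) where

    -- On the circle made of two copies of (V, ≺), x tells which copy a vertex is in
    -- and a cut g determines a half-circle.
    Half : (Fin n → Bool) → Fin n → Set
    Half g w = g w ≡ not (x w)

    half? : ∀ g → U.Decidable (Half g)
    half? g w = g w Bool.≟ not (x w)

    private
      -- If `x a ≡ x c`, the cuts `gd` and `gb` force opposite values of `x b`; if not, `ga` and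
      -- `gc` do.
      noThreeSorted : ∀ {ga gb gc gd a b c} → Cut ga → Cut gb → Cut gc → Cut gd →
        a ≺ b → b ≺ c →
        Half ga a → ga b ≡ x b → ga c ≡ x c →
        gb a ≡ x a → Half gb b → gb c ≡ x c →
        gc a ≡ x a → gc b ≡ x b → Half gc c →
        gd a ≡ x a → gd b ≡ x b → gd c ≡ x c → ⊥
      noThreeSorted {ga} {gb} {gc} {gd} {a} {b} {c} cuta cutb cutc cutd a≺b b≺c
        aa ab ac ba bb bc ca cb cc da db dc =
        bits (x a) (x b) (x c) (at cuta aa ab ac) (at cutb ba bb bc) (at cutc ca cb cc) (at cutd da db dc)
        where
        at : ∀ {g p q r} → Cut g → g a ≡ p → g b ≡ q → g c ≡ r → p ≡ r → q ≡ p
        at cut refl refl refl = cut a≺b b≺c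
        bits : ∀ p q r → (not p ≡ r → q ≡ not p) → (p ≡ r → not q ≡ p) →
               (p ≡ not r → q ≡ p) → (p ≡ r → q ≡ p) → ⊥
        bits p q r ha hb hc hd with p Bool.≟ r
        ... | yes p≡r = Bool.not-¬ refl (trans (hd p≡r) (sym (hb p≡r)))
        ... | no p≢r  = Bool.not-¬ (hc p≡¬r) (ha (trans (cong not p≡¬r) (Bool.not-involutive r)))
          where p≡¬r = Bool.¬-not p≢r

      record Private (g₁ g₂ g₃ g₄ : Fin n → Bool) : Set where
        constructor priv
        field
          w   : Fin n
          own : Half g₁ w
          o₂  : g₂ w ≡ x w
          o₃  : g₃ w ≡ x w
          o₄  : g₄ w ≡ x w

      noThree : ∀ {g₁ g₂ g₃ g₄} → Cut g₁ → Cut g₂ → Cut g₃ → Cut g₄ →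
        Private g₁ g₂ g₃ g₄ → Private g₂ g₁ g₃ g₄ → Private g₃ g₁ g₂ g₄ → ⊥
      noThree {g₁} {g₂} {g₃} {g₄} c₁ c₂ c₃ c₄
        (priv u u₁ u₂ u₃ u₄) (priv v v₂ v₁ v₃ v₄) (priv w w₃ w₁ w₂ w₄)
        with ≺-cmp u v | ≺-cmp v w | ≺-cmp u w
      ... | tri≈ _ refl _ | _ | _ = Bool.not-¬ v₁ u₁
      ... | _ | tri≈ _ refl _ | _ = Bool.not-¬ w₂ v₂
      ... | _ | _ | tri≈ _ refl _ = Bool.not-¬ w₁ u₁
      ... | tri< u≺v _ _ | tri< v≺w _ _ | _ =
        noThreeSorted c₁ c₂ c₃ c₄ u≺v v≺w u₁ v₁ w₁ u₂ v₂ w₂ u₃ v₃ w₃ u₄ v₄ w₄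
      ... | tri> _ _ v≺u | tri> _ _ w≺v | _ =
        noThreeSorted c₃ c₂ c₁ c₄ w≺v v≺u w₃ v₃ u₃ w₂ v₂ u₂ w₁ v₁ u₁ w₄ v₄ u₄
      ... | tri< u≺v _ _ | tri> _ _ w≺v | tri< u≺w _ _ =
        noThreeSorted c₁ c₃ c₂ c₄ u≺w w≺v u₁ w₁ v₁ u₃ w₃ v₃ u₂ w₂ v₂ u₄ w₄ v₄
      ... | tri< u≺v _ _ | tri> _ _ w≺v | tri> _ _ w≺u =
        noThreeSorted c₃ c₁ c₂ c₄ w≺u u≺v w₃ u₃ v₃ w₁ u₁ v₁ w₂ u₂ v₂ w₄ u₄ v₄
      ... | tri> _ _ v≺u | tri< v≺w _ _ | tri< u≺w _ _ =
        noThreeSorted c₂ c₁ c₃ c₄ v≺u u≺w v₂ u₂ w₂ v₁ u₁ w₁ v₃ u₃ w₃ v₄ u₄ w₄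
      ... | tri> _ _ v≺u | tri< v≺w _ _ | tri> _ _ w≺u =
        noThreeSorted c₂ c₃ c₁ c₄ v≺w w≺u v₂ w₂ u₂ v₃ w₃ u₃ v₁ w₁ u₁ v₄ w₄ u₄

    Half₃ : (g₁ g₂ g₃ : Fin n → Bool) → Fin n → Set
    Half₃ g₁ g₂ g₃ w = Half g₁ w ⊎ Half g₂ w ⊎ Half g₃ w

    private
      redundant? : ∀ g₁ g₂ g₃ g₄ → (Half g₁ U.⊆ Half₃ g₂ g₃ g₄) ⊎ Private g₁ g₂ g₃ g₄
      redundant? g₁ g₂ g₃ g₄
        with all? (λ w → half? g₁ w →-dec (half? g₂ w ⊎-dec (half? g₃ w ⊎-dec half? g₄ w)))
      ... | yes all = inj₁ (λ {w} → all w)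
      ... | no ¬all with ¬∀⟶∃¬ n _ (λ w → half? g₁ w →-dec (half? g₂ w ⊎-dec (half? g₃ w ⊎-dec half? g₄ w))) ¬all
      ...   | w , ¬imp = inj₂ (priv w
        (decidable-stable (half? g₁ w) (λ ¬h → ¬imp (λ h → contradiction h ¬h)))
        (out (λ h → ¬imp (λ _ → inj₁ h)))
        (out (λ h → ¬imp (λ _ → inj₂ (inj₁ h))))
        (out (λ h → ¬imp (λ _ → inj₂ (inj₂ h)))))
        where
        out : ∀ {p q} → p ≢ not q → p ≡ q
        out {p} {q} p≢¬q = trans (Bool.¬-not p≢¬q) (Bool.not-involutive q)

    exchange : ∀ {g₁ g₂ g₃ g₄} → Cut g₁ → Cut g₂ → Cut g₃ → Cut g₄ →
      (Half₃ g₁ g₂ g₃ U.⊆ Half₃ g₂ g₃ g₄) ⊎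
      (Half₃ g₁ g₂ g₃ U.⊆ Half₃ g₁ g₃ g₄) ⊎
      (Half₃ g₁ g₂ g₃ U.⊆ Half₃ g₁ g₂ g₄)
    exchange {g₁} {g₂} {g₃} {g₄} c₁ c₂ c₃ c₄
      with redundant? g₁ g₂ g₃ g₄ | redundant? g₂ g₁ g₃ g₄ | redundant? g₃ g₁ g₂ g₄
    ... | inj₁ r₁ | _ | _ = inj₁ [ r₁ , Sum.map₂ inj₁ ]′
    ... | _ | inj₁ r₂ | _ = inj₂ (inj₁ [ inj₁ , [ r₂ , inj₂ ∘ inj₁ ]′ ]′)
    ... | _ | _ | inj₁ r₃ = inj₂ (inj₂ [ inj₁ , [ inj₂ ∘ inj₁ , r₃ ]′ ]′)
    ... | inj₂ p₁ | inj₂ p₂ | inj₂ p₃ = ⊥-elim (noThree c₁ c₂ c₃ c₄ p₁ p₂ p₃)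

-- The order of the vertices around v

Alternates : (Fin n → Bool) → (a b c : Fin n) → Bool → Set
Alternates f a b c p = f a ≡ p × f b ≡ not p × f c ≡ p

module Around {n} (𝓕 : Hypergraph n) (aba : ABA-free 𝓕) (v : Fin n) where

  lookup-aba : ∀ {F F′ a b c} p → F ∈ₗ 𝓕 → F′ ∈ₗ 𝓕 → a < b → b < c →
    Alternates (lookup F) a b c p → Alternates (lookup F′) a b c (not p) → ⊥
  lookup-aba {F} {F′} {a} {b} {c} true F∈ F′∈ a<b b<c (Fa , Fb , Fc) (F′a , F′b , F′c) =
    aba F F′ F∈ F′∈ a b c a<b b<c
      ( (lookup-∈ Fa , lookup-∉ F′a) , (lookup-∈ Fc , lookup-∉ F′c) , (lookup-∈ F′b , lookup-∉ Fb))
  lookup-aba {F} {F′} {a} {b} {c} false F∈ F′∈ a<b b<c (Fa , Fb , Fc) (F′a , F′b , F′c) =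
    aba F′ F F′∈ F∈ a b c a<b b<c
      ( (lookup-∈ F′a , lookup-∉ Fa) , (lookup-∈ F′c , lookup-∉ Fc) , (lookup-∈ Fb , lookup-∉ F′b))

  -- Marks the vertices before `v`: they come last when the order is read from `v`, and `G` flips
  -- their signs.
  σ : Fin n → Bool
  σ w = does (w <? v)

  G : Subset n → Fin n → Bool
  G F w = σ w xor lookup F w

  infix 4 _⊲_
  data _⊲_ (a b : Fin n) : Set where
    stay : σ a ≡ σ b → a < b → a ⊲ b
    wrap : σ a ≡ false → σ b ≡ true → a ⊲ b

  σ-true : ∀ {w} → σ w ≡ true → w < v
  σ-true {w} = does⇒ (w <? v)

  σ-false : ∀ {w} → σ w ≡ false → ¬ (w < v)
  σ-false {w} = does⇒¬ (w <? v)

  σv≡false : σ v ≡ false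
  σv≡false = dec-false (v <? v) (<-irrefl refl)

  wrapped-< : ∀ {a b} → σ a ≡ false → σ b ≡ true → b < a
  wrapped-< {a} {b} σa σb with <-cmp a v
  ... | tri< a<v _ _  = contradiction a<v (σ-false σa)
  ... | tri≈ _ refl _ = σ-true σb
  ... | tri> _ _ v<a  = <-trans (σ-true σb) v<a

  private
    clash : ∀ {b : Bool} {A : Set} → b ≡ true → b ≡ false → A
    clash refl ()

  ⊲-irrefl : ∀ {a} → ¬ (a ⊲ a)
  ⊲-irrefl (stay _ a<a) = <-irrefl refl a<a
  ⊲-irrefl (wrap σf σt) = clash σt σf

  ⊲-trans : Transitive _⊲_
  ⊲-trans (stay ab a<b) (stay bc b<c) = stay (trans ab bc) (<-trans a<b b<c)
  ⊲-trans (stay ab _)   (wrap b c)    = wrap (trans ab b) c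
  ⊲-trans (wrap a b)    (stay bc _)   = wrap a (trans (sym bc) b)
  ⊲-trans (wrap a b)    (wrap b′ c)   = clash b b′

  ⊲-total : ∀ {a b} → a ≢ b → a ⊲ b ⊎ b ⊲ a
  ⊲-total {a} {b} a≢b with σ a in σa | σ b in σb
  ... | false | true  = inj₁ (wrap σa σb)
  ... | true  | false = inj₂ (wrap σb σa)
  ... | true  | true  with <-cmp a b
  ...   | tri< a<b _ _ = inj₁ (stay (trans σa (sym σb)) a<b)
  ...   | tri≈ _ a≡b _ = contradiction a≡b a≢b
  ...   | tri> _ _ b<a = inj₂ (stay (trans σb (sym σa)) b<a)
  ⊲-total {a} {b} a≢b | false | false with <-cmp a b
  ...   | tri< a<b _ _ = inj₁ (stay (trans σa (sym σb)) a<b)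
  ...   | tri≈ _ a≡b _ = contradiction a≡b a≢b
  ...   | tri> _ _ b<a = inj₂ (stay (trans σb (sym σa)) b<a)

  v⊲ : ∀ {w} → w ≢ v → v ⊲ w
  v⊲ {w} w≢v with σ w in σw
  ... | true = wrap σv≡false σw
  ... | false with <-cmp v w
  ...   | tri< v<w _ _ = stay (trans σv≡false (sym σw)) v<w
  ...   | tri≈ _ v≡w _ = contradiction (sym v≡w) w≢v
  ...   | tri> _ _ w<v = contradiction w<v (σ-false σw)

  ⊲-isStrictTotalOrder : IsStrictTotalOrder _≡_ _⊲_
  ⊲-isStrictTotalOrder = isSTO ⊲-irrefl ⊲-trans _≟_ ⊲-total

  private
    unshift : ∀ s {x p} → s xor x ≡ p → x ≡ s xor p
    unshift false eq = eq
    unshift true  {x} eq = trans (sym (Bool.not-involutive x)) (cong not eq)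

    read : ∀ E w {s p} → G E w ≡ p → σ w ≡ s → lookup E w ≡ s xor p
    read E w eq refl = unshift (σ w) eq

    not² = Bool.not-involutive

  -- Moving the last entry of an alternating triple to the front and flipping its sign gives an
  -- alternating triple again. Undoing the wrap in this way leads back to `lookup-aba`.
  aba-cyclic : ∀ {F F′ a b c} p → F ∈ₗ 𝓕 → F′ ∈ₗ 𝓕 → a ⊲ b → b ⊲ c →
    Alternates (G F) a b c p → Alternates (G F′) a b c (not p) → ⊥
  aba-cyclic {F} {F′} {a} {b} {c} p F∈ F′∈ (stay ab a<b) (stay bc b<c) alt alt′ =
    lookup-aba (σ a xor p) F∈ F′∈ a<b b<c (turn F p alt)
      (subst (Alternates (lookup F′) a b c) (sym (Bool.not-distribʳ-xor (σ a) p)) (turn F′ (not p) alt′))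
    where
    turn : ∀ E q → Alternates (G E) a b c q → Alternates (lookup E) a b c (σ a xor q)
    turn E q (Ea , Eb , Ec) =
      read E a Ea refl ,
      trans (read E b Eb (sym ab)) (sym (Bool.not-distribʳ-xor (σ a) q)) ,
      read E c Ec (sym (trans ab bc))
  aba-cyclic {F} {F′} {a} {b} {c} p F∈ F′∈ (stay ab a<b) (wrap σb σc) alt alt′ =
    lookup-aba (not p) F∈ F′∈ (wrapped-< (trans ab σb) σc) a<b (turn F p alt) (turn F′ (not p) alt′)
    where
    turn : ∀ E q → Alternates (G E) a b c q → Alternates (lookup E) c a b (not q)
    turn E q (Ea , Eb , Ec) =
      read E c Ec σc , trans (read E a Ea (trans ab σb)) (sym (not² q)) , read E b Eb σb
  aba-cyclic {F} {F′} {a} {b} {c} p F∈ F′∈ (wrap σa σb) (stay bc b<c) alt alt′ =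
    lookup-aba p F∈ F′∈ b<c (wrapped-< σa (trans (sym bc) σb)) (turn F p alt) (turn F′ (not p) alt′)
    where
    turn : ∀ E q → Alternates (G E) a b c q → Alternates (lookup E) b c a q
    turn E q (Ea , Eb , Ec) =
      trans (read E b Eb σb) (not² q) , read E c Ec (trans (sym bc) σb) , read E a Ea σa
  aba-cyclic p F∈ F′∈ (wrap _ σb) (wrap σb′ _) _ _ = clash σb σb′

  T : Rel (Fin n) 0ℓ
  T a b = Any (λ F → Alternates (G F) v a b false) 𝓕

  T? : Decidable T
  T? a b = Any.any? (λ F → (G F v Bool.≟ false) ×-dec ((G F a Bool.≟ true) ×-dec (G F b Bool.≟ false))) 𝓕

  -- If neither the witness `F` for `a`, `b` nor the witness `F′` for `b`, `c` serves for `a`, `c`,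
  -- then on `a`, `b`, `c` they have signs (+,-,+) and (-,+,-).
  T-closed : ∀ {a b c} → a ⊲ b → b ⊲ c → T a b → T b c → T a c
  T-closed {a} {b} {c} a⊲b b⊲c ab bc with find ab | find bc
  ... | F , F∈ , Fv , Fa , Fb | F′ , F′∈ , F′v , F′b , F′c with G F c in Fc | G F′ a in F′a
  ...   | false | _     = lose F∈ (Fv , Fa , Fc)
  ...   | true  | true  = lose F′∈ (F′v , F′a , F′c)
  ...   | true  | false = ⊥-elim (aba-cyclic true F∈ F′∈ a⊲b b⊲c (Fa , Fb , Fc) (F′a , F′b , F′c))

  T-coclosed : ∀ {a b c} → a ⊲ b → b ⊲ c → T a c → T a b ⊎ T b c
  T-coclosed {b = b} _ _ ac with find ac
  ... | F , F∈ , Fv , Fa , Fc with G F b in Fb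
  ...   | false = inj₁ (lose F∈ (Fv , Fa , Fb))
  ...   | true  = inj₂ (lose F∈ (Fv , Fb , Fc))

  open Inversion ⊲-isStrictTotalOrder T? T-closed T-coclosed public
  open IsStrictTotalOrder ≺-isStrictTotalOrder public using () renaming (asym to ≺-asym)
  open Cuts ≺-isStrictTotalOrder public

  -- The global sign `c` makes room for complements and for the value of `X` at `v`.
  Row : (Fin n → Bool) → Set
  Row k = ∃[ F ] ∃[ c ] (F ∈ₗ 𝓕 × (∀ w → k w ≡ c xor G F w))

  -- The rows differ at `v`, so `v` is not among the vertices where they agree and precedes all of
  -- these in `⊲`. The global signs `s` and `s′` then determine the signs of `F` and `F′` at `v`,
  -- which gives four cases.
  row-noAlt : ∀ {k l} → Row k → Row l → k v ≡ true → l v ≡ false →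
    ∀ {a b c} p → a ≺ b → b ≺ c → Agree k l a p → Agree k l b (not p) → Agree k l c p → ⊥
  row-noAlt {k} {l} (F , s , F∈ , k≡) (F′ , s′ , F′∈ , l≡) kv lv = go s s′ k≡ l≡
    where
    v⊲agree : ∀ {w p} → Agree k l w p → v ⊲ w
    v⊲agree (kp , lp) = v⊲ λ { refl → clash kv (trans kp (trans (sym lp) lv)) }

    at : ∀ {m : Fin n → Bool} E t → (∀ w → m w ≡ t xor G E w) → ∀ {w p} → m w ≡ p → G E w ≡ t xor p
    at E t m≡ {w} mp = unshift t (trans (sym (m≡ w)) mp)

    -- Where the rows agree, with opposite values at a and b, one of them either witnesses
    -- T for a, b or, having signs (+,−,+) on v and these two, excludes any such witness.
    go : ∀ s s′ → (∀ w → k w ≡ s xor G F w) → (∀ w → l w ≡ s′ xor G F′ w) →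
      ∀ {a b c} p → a ≺ b → b ≺ c → Agree k l a p → Agree k l b (not p) → Agree k l c p → ⊥
    -- `F` is + and `F′` is - at `v`: along `≺` the agreed values can only rise.
    go false false k≡ l≡ {a} {b} {c} p a≺b b≺c = split p
      where
      up : ∀ {a b} → Agree k l a true → Agree k l b false → b ≺ a
      up da db with ⊲-total (λ { refl → clash (proj₁ da) (proj₁ db) })
      ... | inj₁ a⊲b = inj₂ (a⊲b , lose F′∈ (at F′ false l≡ lv , at F′ false l≡ (proj₂ da) , at F′ false l≡ (proj₂ db)))
      ... | inj₂ b⊲a = inj₁ (b⊲a , λ t → let (E , E∈ , alt) = find t in
              aba-cyclic true F∈ E∈ (v⊲agree db) b⊲a (at F false k≡ kv , at F false k≡ (proj₁ db) , at F false k≡ (proj₁ da)) alt)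
      split : ∀ p → Agree k l a p → Agree k l b (not p) → Agree k l c p → ⊥
      split true  da db dc = ≺-asym a≺b (up da db)
      split false da db dc = ≺-asym b≺c (up db dc)
    -- `F` is - and `F′` is + at `v`: along `≺` the agreed values can only fall.
    go true true k≡ l≡ {a} {b} {c} p a≺b b≺c = split p
      where
      down : ∀ {a b} → Agree k l a true → Agree k l b false → a ≺ b
      down da db with ⊲-total (λ { refl → clash (proj₁ da) (proj₁ db) })
      ... | inj₁ a⊲b = inj₁ (a⊲b , λ t → let (E , E∈ , alt) = find t in
              aba-cyclic true F′∈ E∈ (v⊲agree da) a⊲b (at F′ true l≡ lv , at F′ true l≡ (proj₂ da) , at F′ true l≡ (proj₂ db)) alt)
      ... | inj₂ b⊲a = inj₂ (b⊲a , lose F∈ (at F true k≡ kv , at F true k≡ (proj₁ db) , at F true k≡ (proj₁ da)))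
      split : ∀ p → Agree k l a p → Agree k l b (not p) → Agree k l c p → ⊥
      split true  da db dc = ≺-asym b≺c (down dc db)
      split false da db dc = ≺-asym a≺b (down db da)
    -- Both are + at `v` and opposite to each other where the rows agree. One of them prevents the
    -- reversal of each consecutive pair, so the alternation already occurs in `⊲`.
    go false true k≡ l≡ p a≺b b≺c da db dc =
      aba-cyclic p F∈ F′∈ (keep p a≺b da db) (keep′ p b≺c db dc)
        (at F false k≡ (proj₁ da) , at F false k≡ (proj₁ db) , at F false k≡ (proj₁ dc))
        (at F′ true l≡ (proj₂ da) , at F′ true l≡ (proj₂ db) , at F′ true l≡ (proj₂ dc))
      where
      keep : ∀ {a b} p → a ≺ b → Agree k l a p → Agree k l b (not p) → a ⊲ b
      keep p (inj₁ (a⊲b , _)) _ _ = a⊲b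
      keep true (inj₂ (b⊲a , t)) da db = let (E , E∈ , alt) = find t in
        ⊥-elim (aba-cyclic true F∈ E∈ (v⊲agree db) b⊲a (at F false k≡ kv , at F false k≡ (proj₁ db) , at F false k≡ (proj₁ da)) alt)
      keep false (inj₂ (b⊲a , t)) da db = let (E , E∈ , alt) = find t in
        ⊥-elim (aba-cyclic true F′∈ E∈ (v⊲agree db) b⊲a (at F′ true l≡ lv , at F′ true l≡ (proj₂ db) , at F′ true l≡ (proj₂ da)) alt)
      keep′ : ∀ {a b} p → a ≺ b → Agree k l a (not p) → Agree k l b p → a ⊲ b
      keep′ true  = keep false
      keep′ false = keep true
    -- Both are - at `v` and opposite where the rows agree. Now one of them forces the reversal of
    -- each consecutive pair, so the alternation occurs in `⊲` backwards.
    go true false k≡ l≡ p a≺b b≺c da db dc =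
      aba-cyclic (not p) F∈ F′∈ (flip′ p b≺c db dc) (flip p a≺b da db)
        (at F true k≡ (proj₁ dc) , at F true k≡ (proj₁ db) , at F true k≡ (proj₁ da))
        (up (proj₂ dc) , up (proj₂ db) , up (proj₂ da))
      where
      up : ∀ {w q} → l w ≡ q → G F′ w ≡ not (not q)
      up lq = trans (at F′ false l≡ lq) (sym (not² _))
      flip : ∀ {a b} p → a ≺ b → Agree k l a p → Agree k l b (not p) → b ⊲ a
      flip p (inj₂ (b⊲a , _)) _ _ = b⊲a
      flip true (inj₁ (a⊲b , ¬t)) da db =
        contradiction (lose F′∈ (at F′ false l≡ lv , at F′ false l≡ (proj₂ da) , at F′ false l≡ (proj₂ db))) ¬t
      flip false (inj₁ (a⊲b , ¬t)) da db =
        contradiction (lose F∈ (at F true k≡ kv , at F true k≡ (proj₁ da) , at F true k≡ (proj₁ db))) ¬t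
      flip′ : ∀ {a b} p → a ≺ b → Agree k l a (not p) → Agree k l b p → b ⊲ a
      flip′ true  = flip false
      flip′ false = flip true

-- Covering by pairs of hyperedges

-- Inclusion between the sets of hyperedges through `a` and through `b`: a preorder whose minimal
-- elements are the candidates for `v`.
Through : Hypergraph n → Rel (Fin n) 0ℓ
Through 𝓗 a b = All (λ H → a ∈ H → b ∈ H) 𝓗

through? : (𝓗 : Hypergraph n) → Decidable (Through 𝓗)
through? 𝓗 a b = All.all? (λ H → (a ∈? H) →-dec (b ∈? H)) 𝓗

module Pairs {n} (𝓗 𝓕 : Hypergraph n) (X : Subset n) (aba : ABA-free 𝓕)
  (rep : ∀ H → H ∈ₗ 𝓗 → ∃[ F ] (F ∈ₗ 𝓕 × (H ≡ F Δ X ⊎ H ≡ ∁ F Δ X))) (v : Fin n) where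

  open Around 𝓕 aba v

  -- Chosen so that row H equals G F up to a global sign, and row H v ≡ lookup H v.
  x : Fin n → Bool
  x w = lookup X w xor (lookup X v xor σ w)

  row : Subset n → Fin n → Bool
  row H w = lookup H w xor x w

  lookup-rep : ∀ {H} → H ∈ₗ 𝓗 → ∃[ F ] ∃[ c ] (F ∈ₗ 𝓕 × (∀ w → lookup H w ≡ (c xor lookup F w) xor lookup X w))
  lookup-rep {H} H∈ with rep H H∈
  ... | F , F∈ , inj₁ refl = F , false , F∈ , λ w → lookup-zipWith _xor_ w F X
  ... | F , F∈ , inj₂ refl = F , true , F∈ , λ w →
    trans (lookup-zipWith _xor_ w (∁ F) X) (cong (_xor lookup X w) (lookup-map w not F))

  row-Row : ∀ {H} → H ∈ₗ 𝓗 → Row (row H)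
  row-Row H∈ with lookup-rep H∈
  ... | F , c , F∈ , H≡ = F , c xor lookup X v , F∈ , λ w →
    trans (cong (_xor x w) (H≡ w)) (regroup c (lookup F w) (lookup X w) (σ w) (lookup X v))
    where
    open ≡-Reasoning
    regroup : ∀ c f y s z → ((c xor f) xor y) xor (y xor (z xor s)) ≡ (c xor z) xor (s xor f)
    regroup c f y s z = begin
      ((c xor f) xor y) xor (y xor (z xor s))  ≡⟨ Bool.xor-assoc (c xor f) y _ ⟩
      (c xor f) xor (y xor (y xor (z xor s)))  ≡⟨ cong ((c xor f) xor_) (Bool.xor-assoc y y _) ⟨
      (c xor f) xor ((y xor y) xor (z xor s))  ≡⟨ cong (λ e → (c xor f) xor (e xor (z xor s))) (Bool.xor-same y) ⟩
      (c xor f) xor (z xor s)                  ≡⟨ interchange c f z s ⟩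
      (c xor z) xor (f xor s)                  ≡⟨ cong ((c xor z) xor_) (Bool.xor-comm f s) ⟩
      (c xor z) xor (s xor f)                  ∎

  row-v : ∀ H → row H v ≡ lookup H v
  row-v H = trans (cong (lookup H v xor_) x≡false) (Bool.xor-identityʳ _)
    where
    x≡false : x v ≡ false
    x≡false = trans (cong (λ s → lookup X v xor (lookup X v xor s)) σv≡false)
      (trans (cong (lookup X v xor_) (Bool.xor-identityʳ (lookup X v))) (Bool.xor-same (lookup X v)))

  row-∈ : ∀ {H w} → w ∈ H → row H w ≡ not (x w)
  row-∈ {w = w} w∈H = cong (_xor x w) ([]=⇒lookup w∈H)

  row-∉ : ∀ {H w} → w ∉ H → row H w ≡ x w
  row-∉ {w = w} w∉H = cong (_xor x w) (∉-lookup w∉H)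

  record Pair : Set where
    field
      K L : Subset n
      K∈𝓗 : K ∈ₗ 𝓗
      L∈𝓗 : L ∈ₗ 𝓗
      v∈K : v ∈ K
      v∉L : v ∉ L
  open Pair public

  -- Recombining is possible because only membership of `v` ties `K` to `L`; it yields new pairs
  -- without new hyperedges.
  mix : Pair → Pair → Pair
  mix π ρ = record { K = K π ; L = L ρ ; K∈𝓗 = K∈𝓗 π ; L∈𝓗 = L∈𝓗 ρ ; v∈K = v∈K π ; v∉L = v∉L ρ }

  abstract
    cutting : (π : Pair) → Σ[ g ∈ (Fin n → Bool) ] Cut g × (∀ {w} p → Agree (row (K π)) (row (L π)) w p → g w ≡ p)
    cutting π = complete (row (K π)) (row (L π))
      (row-noAlt (row-Row (K∈𝓗 π)) (row-Row (L∈𝓗 π))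
        (trans (row-v (K π)) ([]=⇒lookup (v∈K π))) (trans (row-v (L π)) (∉-lookup (v∉L π))))

  g : Pair → Fin n → Bool
  g π = proj₁ (cutting π)

  g-cut : ∀ π → Cut (g π)
  g-cut π = proj₁ (proj₂ (cutting π))

  -- A set between `K ∩ L` and `K ∪ L`; where `K` and `L` disagree, the cut may choose either value.
  Covers : Pair → Fin n → Set
  Covers π = Half x (g π)

  both⇒covers : ∀ π {w} → w ∈ K π → w ∈ L π → Covers π w
  both⇒covers π {w} w∈K w∈L = proj₂ (proj₂ (cutting π)) (not (x w)) (row-∈ w∈K , row-∈ w∈L)

  covers⇒some : ∀ π {w} → Covers π w → w ∈ K π ⊎ w ∈ L π
  covers⇒some π {w} cov with w ∈? K π | w ∈? L π
  ... | yes w∈K | _       = inj₁ w∈K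
  ... | no _    | yes w∈L = inj₂ w∈L
  ... | no w∉K  | no w∉L  =
    contradiction cov (Bool.not-¬ (proj₂ (proj₂ (cutting π)) (x w) (row-∉ w∉K , row-∉ w∉L)))

  Triple : (π ρ τ : Pair) → Fin n → Set
  Triple π ρ τ = Half₃ x (g π) (g ρ) (g τ)

  exchangePairs : ∀ π ρ τ υ → (Triple π ρ τ U.⊆ Triple ρ τ υ) ⊎ (Triple π ρ τ U.⊆ Triple π τ υ) ⊎ (Triple π ρ τ U.⊆ Triple π ρ υ)
  exchangePairs π ρ τ υ = exchange x (g-cut π) (g-cut ρ) (g-cut τ) (g-cut υ)

  Universal : Fin n → Set
  Universal w = ∀ {H} → H ∈ₗ 𝓗 → v ∈ H → w ∈ H

  -- If every hyperedge through `w` contains `v`, minimality of `v` gives the converse. Otherwise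
  -- some `L` contains `w` but not `v`, and a hyperedge `K` joining `v` and `w` completes the pair.
  universal-or-covered : (∀ (u w : Fin n) → u ≢ w → ∃[ H ] (H ∈ₗ 𝓗 × u ∈ H × w ∈ H)) →
    (∀ w → Through 𝓗 w v → Through 𝓗 v w) →
    ∀ w → Universal w ⊎ Σ[ π ∈ Pair ] Covers π w
  universal-or-covered joined v-min w with through? 𝓗 w v
  ... | yes w≲v = inj₁ (All.lookup (v-min w w≲v))
  ... | no w≴v with find (¬All⇒Any¬ (λ H → (w ∈? H) →-dec (v ∈? H)) 𝓗 w≴v)
  ...   | L , L∈ , ¬imp with joined v w (λ { refl → ¬imp id })
  ...     | K , K∈ , v∈K , w∈K = inj₂ (π , both⇒covers π w∈K w∈L)
    where
    w∈L : w ∈ L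
    w∈L = decidable-stable (w ∈? L) (λ w∉L → ¬imp (λ w∈L → contradiction w∈L w∉L))
    π : Pair
    π = record { K = K ; L = L ; K∈𝓗 = K∈ ; L∈𝓗 = L∈ ; v∈K = v∈K ; v∉L = λ v∈L → ¬imp (λ _ → v∈L) }

  -- From covering pairs to four hyperedges

  module _ (covered : ∀ w → Universal w ⊎ Σ[ π ∈ Pair ] Covers π w) where

    -- Each new vertex brings a pair `υ` covering it; `exchange` keeps `υ` and discards one of the
    -- three earlier pairs without losing a covered vertex.
    threePairs : ∀ ws → All Universal ws ⊎
      (∃[ π ] ∃[ ρ ] ∃[ τ ] All (λ w → Universal w ⊎ Triple π ρ τ w) ws)
    threePairs [] = inj₁ []
    threePairs (w ∷ ws) with covered w | threePairs ws
    ... | inj₁ u | inj₁ us = inj₁ (u ∷ us)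
    ... | inj₁ u | inj₂ (π , ρ , τ , cov) = inj₂ (π , ρ , τ , inj₁ u ∷ cov)
    -- The first pair is repeated to fill all three places.
    ... | inj₂ (π , πw) | inj₁ us = inj₂ (π , π , π , inj₂ (inj₁ πw) ∷ All.map inj₁ us)
    ... | inj₂ (υ , υw) | inj₂ (π , ρ , τ , cov) with exchangePairs π ρ τ υ
    ...   | inj₁ s        = inj₂ (ρ , τ , υ , inj₂ (inj₂ (inj₂ υw)) ∷ All.map (Sum.map₂ s) cov)
    ...   | inj₂ (inj₁ s) = inj₂ (π , τ , υ , inj₂ (inj₂ (inj₂ υw)) ∷ All.map (Sum.map₂ s) cov)
    ...   | inj₂ (inj₂ s) = inj₂ (π , ρ , υ , inj₂ (inj₂ (inj₂ υw)) ∷ All.map (Sum.map₂ s) cov)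

    FourCover : Set
    FourCover = ∃[ 𝓒 ] (length 𝓒 ≤ 4 × All (_∈ₗ 𝓗) 𝓒 × ⋃ 𝓒 ≡ ⊤)

    _⊑_ : Pair → List (Subset n) → Set
    π ⊑ 𝓒 = K π ∈ₗ 𝓒 × L π ∈ₗ 𝓒

    finish : ∀ {π ρ τ} (𝓒 : List (Subset n)) → length 𝓒 ≤ 4 → All (_∈ₗ 𝓗) 𝓒 → π ⊑ 𝓒 → ρ ⊑ 𝓒 → τ ⊑ 𝓒 →
      (∀ w → Universal w ⊎ Triple π ρ τ w) → FourCover
    finish {π} {ρ} {τ} 𝓒 |𝓒|≤4 𝓒⊆𝓗 π⊑ ρ⊑ τ⊑ cov = 𝓒 , |𝓒|≤4 , 𝓒⊆𝓗 , ⋃≡⊤ 𝓒 (hit ∘ cov)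
      where
      pick : ∀ υ {w} → υ ⊑ 𝓒 → Covers υ w → Any (w ∈_) 𝓒
      pick υ (K∈ , L∈) c = [ lose K∈ , lose L∈ ]′ (covers⇒some υ c)
      hit : ∀ {w} → Universal w ⊎ Triple π ρ τ w → Any (w ∈_) 𝓒
      -- Any `K` of a pair contains `v`, hence all universal vertices.
      hit (inj₁ u)               = lose (proj₁ π⊑) (u (K∈𝓗 π) (v∈K π))
      hit (inj₂ (inj₁ c))        = pick π π⊑ c
      hit (inj₂ (inj₂ (inj₁ c))) = pick ρ ρ⊑ c
      hit (inj₂ (inj₂ (inj₂ c))) = pick τ τ⊑ c

    pattern #0 = here refl
    pattern #1 = there #0
    pattern #2 = there #1
    pattern #3 = there #2

    four : ∀ {A B C D} → A ∈ₗ 𝓗 → B ∈ₗ 𝓗 → C ∈ₗ 𝓗 → D ∈ₗ 𝓗 → All (_∈ₗ 𝓗) (A ∷ B ∷ C ∷ D ∷ [])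
    four a b c d = a ∷ b ∷ c ∷ d ∷ []

    -- Three pairs use six hyperedges. Bringing in `mix π ρ` and dropping `τ` leaves four; dropping
    -- `π` or `ρ` leaves five, and a second mixed pair removes one more.
    kirchberger : ∀ π ρ τ → (∀ w → Universal w ⊎ Triple π ρ τ w) → FourCover
    kirchberger π ρ τ cov with exchangePairs π ρ τ (mix π ρ)
    ... | inj₂ (inj₂ s) =
      finish (K π ∷ K ρ ∷ L π ∷ L ρ ∷ []) ≤-refl (four (K∈𝓗 π) (K∈𝓗 ρ) (L∈𝓗 π) (L∈𝓗 ρ))
        (#0 , #2) (#1 , #3) (#0 , #3) (Sum.map₂ s ∘ cov)
    -- `L π` is gone. With `mix τ ρ` added, dropping `ρ`, `τ` or `mix π ρ` frees `K ρ`, `L τ` or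
    -- `K π` respectively.
    ... | inj₁ s with exchangePairs ρ τ (mix π ρ) (mix τ ρ)
    ...   | inj₁ s′ =
      finish (K τ ∷ K π ∷ L τ ∷ L ρ ∷ []) ≤-refl (four (K∈𝓗 τ) (K∈𝓗 π) (L∈𝓗 τ) (L∈𝓗 ρ))
        (#0 , #2) (#1 , #3) (#0 , #3) (Sum.map₂ (s′ ∘ s) ∘ cov)
    ...   | inj₂ (inj₁ s′) =
      finish (K ρ ∷ K π ∷ K τ ∷ L ρ ∷ []) ≤-refl (four (K∈𝓗 ρ) (K∈𝓗 π) (K∈𝓗 τ) (L∈𝓗 ρ))
        (#0 , #3) (#1 , #3) (#2 , #3) (Sum.map₂ (s′ ∘ s) ∘ cov)
    ...   | inj₂ (inj₂ s′) =
      finish (K ρ ∷ K τ ∷ L ρ ∷ L τ ∷ []) ≤-refl (four (K∈𝓗 ρ) (K∈𝓗 τ) (L∈𝓗 ρ) (L∈𝓗 τ))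
        (#0 , #2) (#1 , #3) (#1 , #2) (Sum.map₂ (s′ ∘ s) ∘ cov)
    -- `K ρ` is gone. With `mix π τ` added, dropping `π`, `τ` or `mix π ρ` frees `L π`, `K τ` or
    -- `L ρ` respectively.
    kirchberger π ρ τ cov | inj₂ (inj₁ s) with exchangePairs π τ (mix π ρ) (mix π τ)
    ...   | inj₁ s′ =
      finish (K τ ∷ K π ∷ L τ ∷ L ρ ∷ []) ≤-refl (four (K∈𝓗 τ) (K∈𝓗 π) (L∈𝓗 τ) (L∈𝓗 ρ))
        (#0 , #2) (#1 , #3) (#1 , #2) (Sum.map₂ (s′ ∘ s) ∘ cov)
    ...   | inj₂ (inj₁ s′) =
      finish (K π ∷ L π ∷ L ρ ∷ L τ ∷ []) ≤-refl (four (K∈𝓗 π) (L∈𝓗 π) (L∈𝓗 ρ) (L∈𝓗 τ))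
        (#0 , #1) (#0 , #2) (#0 , #3) (Sum.map₂ (s′ ∘ s) ∘ cov)
    ...   | inj₂ (inj₂ s′) =
      finish (K π ∷ K τ ∷ L π ∷ L τ ∷ []) ≤-refl (four (K∈𝓗 π) (K∈𝓗 τ) (L∈𝓗 π) (L∈𝓗 τ))
        (#0 , #2) (#1 , #3) (#0 , #3) (Sum.map₂ (s′ ∘ s) ∘ cov)

    fourCover : ∀ {H} → H ∈ₗ 𝓗 → v ∈ H → FourCover
    fourCover {H} H∈ v∈H with threePairs (allFin n)
    -- All vertices are universal, so a single hyperedge through `v` is already all of `V`.
    ... | inj₁ us = H ∷ [] , s≤s z≤n , H∈ ∷ [] ,
      ⋃≡⊤ (H ∷ []) (λ w → here (All.lookup us (∈-allFin w) H∈ v∈H))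
    ... | inj₂ (π , ρ , τ , cov) = kirchberger π ρ τ (λ w → All.lookup cov (∈-allFin w))

mainTheorem7 : (n : ℕ) → 2 ≤ n → (𝓗 : Hypergraph n) → IsPseudohemisphere 𝓗 →
    (∀ (u v : Fin n) → u ≢ v → ∃[ H ] (H ∈ₗ 𝓗 × u ∈ H × v ∈ H)) →
    ∃[ 𝓒 ] (length 𝓒 ≤ 4 × All (λ H → H ∈ₗ 𝓗) 𝓒 × ⋃ 𝓒 ≡ ⊤)
mainTheorem7 (ℕ.suc (ℕ.suc m)) (s≤s (s≤s z≤n)) 𝓗 (X , 𝓕 , aba , rep) joined =
  -- The list is `zero` followed by all vertices, so each vertex is found in its tail.
  let (v , v-min) = minimal {_≲_ = Through 𝓗} (All.tabulate (λ _ → id)) ≲-trans (through? 𝓗) zero (allFin _)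
      -- A second vertex exists as n is at least 2; joining it to `v` provides a hyperedge through
      -- `v`.
      (u , v≢u) = other v
      (H , H∈ , v∈H , _) = joined v u v≢u
      open Pairs 𝓗 𝓕 X aba rep v
  in fourCover (universal-or-covered joined (λ w → v-min (there (∈-allFin w)))) H∈ v∈H
  where
  ≲-trans : Transitive (Through 𝓗)
  ≲-trans a≲b b≲c = All.zipWith (λ (f , h) → h ∘ f) (a≲b , b≲c)

  other : (a : Fin (ℕ.suc (ℕ.suc m))) → ∃[ b ] a ≢ b
  other zero    = suc zero , λ ()
  other (suc _) = zero , λ ()
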